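{- Let $n,k$ be integers with $n>4$ and $1\leq k\leq n$. The maximum size $|E(G)|$ of a connected graph $G$ of order $n$ with $mvd(G)=k$ is: $\frac{n(n-1)}{2}-2$ if $k=1$ (and $n\geq 5$); $7$ if $k=2$ and $n=5$; $\frac{n(n-1)}{2}-4$ if $k=2$ and $n\geq 6$; $\frac{n(n-1)}{2}-k+2$ if $3\leq k\leq n-1$; and $\frac{n(n-1)}{2}$ if $k=n$.
   Context: All graphs are finite, simple and undirected. For a vertex-colored graph and two nonadjacent vertices $x,y$, an $x$-$y$ vertex cut is a set $S\subseteq V(G)\setminus\{x,y\}$ such that $x$ and $y$ lie in different components of $G-S$; it is monochromatic if all its vertices have the same color. A vertex-coloring is an MVD-coloring if every pair of nonadjacent vertices has a monochromatic vertex cut separating them. $mvd(G)$ is the maximum number of colors used by an MVD-coloring of $G$. -}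

module Defs where

open import Data.Nat using (ℕ; _*_; _∸_; _<ᵇ_; _≤_)
open import Data.Nat.DivMod using (_/_)
open import Data.Bool using (Bool; true; false; if_then_else_; _∧_)
open import Data.Fin using (Fin; toℕ)
open import Data.Fin.Subset using (Subset; _∈_; _∉_)
open import Data.List using (List; map; allFin)
open import Data.Nat.ListAction using (sum)
open import Data.Product using (Σ; _×_; ∃)
open import Data.Unit using (⊤)
open import Function.Definitions using (Surjective)
open import Relation.Nullary using (¬_)
open import Relation.Binary.PropositionalEquality using (_≡_; _≢_)

record Graph (n : ℕ) : Set where
  field
    adj    : Fin n → Fin n → Bool
    sym    : ∀ i j → adj i j ≡ adj j i
    irrefl : ∀ i → adj i i ≡ false
open Graph public

edgeCount : ∀ {n} → Graph n → ℕ
edgeCount {n} G =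
  sum (map (λ i → sum (map (λ j → if (toℕ j <ᵇ toℕ i) ∧ adj G i j then 1 else 0)
                           (allFin n)))
           (allFin n))

data Path {n : ℕ} (G : Graph n) (allowed : Fin n → Set) : Fin n → Fin n → Set where
  here : ∀ {x} → allowed x → Path G allowed x x
  step : ∀ {x y z} → allowed x → adj G x y ≡ true → Path G allowed y z → Path G allowed x z

Connected : ∀ {n} → Graph n → Set
Connected G = ∀ x y → Path G (λ _ → ⊤) x y

IsVertexCut : ∀ {n} → Graph n → Fin n → Fin n → Subset n → Set
IsVertexCut G x y S = x ∉ S × y ∉ S × ¬ Path G (λ v → v ∉ S) x y

Monochromatic : ∀ {n m} → (Fin n → Fin m) → Subset n → Set
Monochromatic c S = ∀ u v → u ∈ S → v ∈ S → c u ≡ c v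

IsMVDColoring : ∀ {n m} → Graph n → (Fin n → Fin m) → Set
IsMVDColoring G c = ∀ x y → x ≢ y → adj G x y ≡ false →
  Σ _ λ S → IsVertexCut G x y S × Monochromatic c S

-- A colouring using exactly m colours is a surjection Fin n → Fin m.
-- mvd(G) ≡ k : some MVD-coloring uses exactly k colours, and every MVD-coloring
-- uses at most k colours.
MvdIs : ∀ {n} → Graph n → ℕ → Set
MvdIs {n} G k =
  (Σ (Fin n → Fin k) λ c → Surjective _≡_ _≡_ c × IsMVDColoring G c) ×
  (∀ m (c : Fin n → Fin m) → Surjective _≡_ _≡_ c → IsMVDColoring G c → m ≤ k)

MaxEdges : ℕ → ℕ → ℕ → Set
MaxEdges n k M =
  (Σ (Graph n) λ G → Connected G × MvdIs G k × edgeCount G ≡ M) ×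
  (∀ (G : Graph n) → Connected G → MvdIs G k → edgeCount G ≤ M)

choose2 : ℕ → ℕ
choose2 n = (n * (n ∸ 1)) / 2

{-# OPTIONS --safe #-}
module Submission where

-- The argument counts missing edges.  Common neighbours of a nonadjacent pair {x , y} share their colour in
-- every MVD-colouring, and every other vertex accounts for a missing edge at x or y; so a noncomplete graph
-- with mvd = k misses at least k − 2 edges.  For k ≤ 2 and few missing edges there are two cases: either some
-- missing edge meets all the others, and then its two ends can be given private colours, so mvd ≥ 3; or some
-- missing edge is disjoint from all the others and there is another one, and then all vertices are forced to
-- share one colour.

open import Defs renaming (sym to adj-sym)
open import Data.Nat using (ℕ; _+_; _∸_; _≤_; _<_)
open import Data.Product using (_×_)
open import Relation.Binary.PropositionalEquality using (_≡_)

open import Data.Bool using (Bool; true; false; if_then_else_; not; _∧_)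
open import Data.Bool.Properties using (T?; T-∧; T-not-≡) renaming (_≟_ to _≟ᵇ_)
open import Data.Fin using (Fin; zero; suc; toℕ; fromℕ<; inject≤; _≟_)
open import Data.Fin.Patterns
open import Data.Fin.Properties using (toℕ<n; toℕ-injective; toℕ-fromℕ<; toℕ-inject≤; injective⇒≤; any?; ¬∀⟶∃¬)
open import Data.Fin.Subset using (Subset; _∈_; _∉_)
open import Data.Fin.Subset.Properties using (_∈?_)
open import Data.List using (List; []; _∷_; _++_; map; length; lookup; tabulate; allFin; filterᵇ; cartesianProduct)
open import Data.List.Membership.Propositional using () renaming (_∈_ to _∈ˡ_; _∉_ to _∉ˡ_)
open import Data.List.Membership.Propositional.Properties using (∈-filter⁺; ∈-filter⁻; ∈-cartesianProduct⁺; ∈-allFin; ∈-lookup; ∈-map⁺; ∈-tabulate⁺; ∈-tabulate⁻)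
open import Data.List.Properties using (filter-++; length-++; length-map; length-tabulate; map-tabulate)
open import Data.List.Relation.Binary.Permutation.Propositional using (_↭_; ↭-refl; ↭-trans; prep; swap)
open import Data.List.Relation.Binary.Permutation.Propositional.Properties using (Any-resp-↭)
open import Data.List.Relation.Binary.Subset.Propositional using (_⊆_)
open import Data.List.Relation.Unary.All as All using (All; []; _∷_)
open import Data.List.Relation.Unary.All.Properties using (tabulate⁺)
open import Data.List.Relation.Unary.Any as Any using (Any; here; there)
open import Data.List.Relation.Unary.Any.Properties using (lookup-index; ++⁺ˡ)
open import Data.List.Relation.Unary.AllPairs using ([]; _∷_)
open import Data.List.Relation.Unary.Unique.Propositional using (Unique)
open import Data.List.Relation.Unary.Unique.Propositional.Properties using (allFin⁺; cartesianProduct⁺; filter⁺)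
open import Data.Nat using (zero; suc; _*_; _<ᵇ_; _⊓_; z≤n; s≤s; s≤s⁻¹)
open import Data.Nat.DivMod using (_/_; m*n/n≡m; /-congˡ; /-monoˡ-≤)
open import Data.Nat.ListAction using (sum)
open import Data.Nat.Properties using (+-assoc; +-comm; +-suc; +-identityʳ; ≤-refl; ≤-trans; ≤-antisym; ≤-reflexive; <-cmp; <-irrefl; <-asym; <⇒<ᵇ; <ᵇ⇒<; ≮⇒≥; +-cancelʳ-≤; +-monoʳ-≤; m≤m+n; m≤n+m∸n; m⊓n≤n; m≤n⇒m⊓n≡m; m≥n⇒m⊓n≡n; ∸-+-assoc; ∸-monoʳ-≤; ∸-monoˡ-≤; *-monoʳ-≤; m∸n+n≡m; m+n∸n≡m; n≤1+n; module ≤-Reasoning)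
open import Data.Nat.Solver using (module +-*-Solver)
open import Data.Product using (Σ; ∃; _,_; proj₁; proj₂)
open import Data.Product.Properties using (≡-dec)
open import Data.Sum using (_⊎_; inj₁; inj₂) renaming (map to map⊎; swap to swap⊎)
open import Data.Empty using (⊥; ⊥-elim)
open import Data.Unit using (⊤; tt)
open import Data.Vec using () renaming (tabulate to tabulateᵛ)
open import Data.Vec.Properties using (lookup∘tabulate; []=⇒lookup; lookup⇒[]=)
open import Function using (_∘_; id; const; case_of_; mk⇔)
open import Function.Bundles using (Equivalence)
open import Function.Definitions using (Surjective; Injective)
open import Relation.Binary.Definitions using (tri<; tri≈; tri>)
open import Relation.Binary.PropositionalEquality using (_≢_; refl; sym; trans; cong; cong₂; subst; module ≡-Reasoning)
open import Relation.Nullary using (¬_; Dec; yes; no; does; contradiction)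
open import Relation.Nullary.Decidable using (_⊎-dec_; _×-dec_; dec-true; dec-false; does-⇔)

-- Counting with lists

-- Sending `v` to a position of `v` in `xs` is injective, because the entry at that position gives
-- `v` back.
covering-length : ∀ {n} (xs : List (Fin n)) → (∀ v → v ∈ˡ xs) → n ≤ length xs
covering-length xs cov = injective⇒≤ {f = λ v → Any.index (cov v)} λ {u} {v} eq →
  trans (lookup-index (cov u)) (trans (cong (lookup xs) eq) (sym (lookup-index (cov v))))

lookup-injective : ∀ {A : Set} {xs : List A} → Unique xs → Injective _≡_ _≡_ (lookup xs)
lookup-injective (_ ∷ _)  {zero}  {zero}  _  = refl
lookup-injective {xs = _ ∷ xs} (px ∷ _) {zero}  {suc j} eq = contradiction eq (All.lookup px (∈-lookup j))
lookup-injective {xs = _ ∷ xs} (px ∷ _) {suc i} {zero}  eq = contradiction (sym eq) (All.lookup px (∈-lookup i))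
lookup-injective (_ ∷ u)  {suc i} {suc j} eq = cong suc (lookup-injective u eq)

unique-⊆⇒length≤ : ∀ {A : Set} {xs ys : List A} → Unique xs → xs ⊆ ys → length xs ≤ length ys
unique-⊆⇒length≤ {xs = xs} {ys} u sub = injective⇒≤ {f = f} λ {i} {j} eq → lookup-injective u
  (trans (lookup-index (sub (∈-lookup i)))
    (trans (cong (lookup ys) eq) (sym (lookup-index (sub (∈-lookup j))))))
  where
  f : Fin (length xs) → Fin (length ys)
  f i = Any.index (sub (∈-lookup i))

fresh : ∀ {n} (xs : List (Fin n)) → length xs < n → ∃ λ v → v ∉ˡ xs
fresh {n} xs lt = ¬∀⟶∃¬ n (_∈ˡ xs) (λ v → Any.any? (v ≟_) xs)
  λ cov → <-irrefl refl (≤-trans lt (covering-length xs cov))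

count : Bool → ℕ
count b = if b then 1 else 0

row-split : ∀ {A B : Set} (p q : A → B → Bool) i (ys : List B) →
  sum (map (λ j → count (p i j ∧ q i j)) ys)
    + length (filterᵇ (λ (i , j) → p i j ∧ not (q i j)) (map (i ,_) ys))
    ≡ sum (map (λ j → count (p i j)) ys)
row-split p q i [] = refl
row-split p q i (y ∷ ys) with p i y | q i y
... | false | _     = row-split p q i ys
... | true  | true  = cong suc (row-split p q i ys)
... | true  | false = trans (+-suc _ _) (cong suc (row-split p q i ys))

-- A pair selected by `p` either satisfies `q` and is counted in the sum, or fails `q` and stays in
-- the filtered list. With `p` the order of the two indices and `q` adjacency, this splits all pairs
-- into edges and missing edges.
table-split : ∀ {A B : Set} (p q : A → B → Bool) (xs : List A) (ys : List B) →
  sum (map (λ i → sum (map (λ j → count (p i j ∧ q i j)) ys)) xs)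
    + length (filterᵇ (λ (i , j) → p i j ∧ not (q i j)) (cartesianProduct xs ys))
    ≡ sum (map (λ i → sum (map (λ j → count (p i j)) ys)) xs)
table-split p q [] ys = refl
table-split {A} {B} p q (x ∷ xs) ys = begin
  (r + s) + length (filterᵇ f (map (x ,_) ys ++ cartesianProduct xs ys))
    ≡⟨ cong ((r + s) +_) (trans (cong length (filter-++ (T? ∘ f) (map (x ,_) ys) _)) (length-++ (filterᵇ f (map (x ,_) ys)))) ⟩
  (r + s) + (a + b)
    ≡⟨ +-*-Solver.solve 4 (λ r s a b → ((r :+ s) :+ (a :+ b)) := ((r :+ a) :+ (s :+ b))) refl r s a b ⟩
  (r + a) + (s + b)
    ≡⟨ cong₂ _+_ (row-split p q x ys) (table-split p q xs ys) ⟩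
  _ ∎
  where
  open ≡-Reasoning
  open +-*-Solver using (_:+_; _:=_)
  f : A × B → Bool
  f (i , j) = p i j ∧ not (q i j)
  r s a b : ℕ
  r = sum (map (λ j → count (p x j ∧ q x j)) ys)
  s = sum (map (λ i → sum (map (λ j → count (p i j ∧ q i j)) ys)) xs)
  a = length (filterᵇ f (map (x ,_) ys))
  b = length (filterᵇ f (cartesianProduct xs ys))

-- The number of pairs below the diagonal

sum-zero : ∀ n → sum (tabulate {n = n} (const 0)) ≡ 0
sum-zero zero    = refl
sum-zero (suc n) = sum-zero n

count-below : ∀ {n} (i : Fin n) → sum (tabulate {n = n} λ j → count (toℕ j <ᵇ toℕ i)) ≡ toℕ i
count-below {suc n} zero    = sum-zero n
count-below {suc n} (suc i) = cong suc (count-below i)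

sum-tabulate-cong : ∀ {n} {f g : Fin n → ℕ} → (∀ i → f i ≡ g i) → sum (tabulate f) ≡ sum (tabulate g)
sum-tabulate-cong {zero}  eq = refl
sum-tabulate-cong {suc n} eq = cong₂ _+_ (eq zero) (sum-tabulate-cong (eq ∘ suc))

sum-tabulate-suc : ∀ {n} (f : Fin n → ℕ) → sum (tabulate (suc ∘ f)) ≡ n + sum (tabulate f)
sum-tabulate-suc {zero}  f = refl
sum-tabulate-suc {suc n} f = cong suc (begin
  f zero + sum (tabulate (suc ∘ f ∘ suc))    ≡⟨ cong (f zero +_) (sum-tabulate-suc (f ∘ suc)) ⟩
  f zero + (n + sum (tabulate (f ∘ suc)))    ≡⟨ +-*-Solver.solve 3 (λ a b c → (a :+ (b :+ c)) := (b :+ (a :+ c))) refl (f zero) n _ ⟩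
  n + (f zero + sum (tabulate (f ∘ suc)))    ∎)
  where
  open ≡-Reasoning
  open +-*-Solver using (_:+_; _:=_)

triangular : ∀ n → sum (tabulate {n = n} toℕ) * 2 ≡ n * (n ∸ 1)
triangular zero = refl
triangular (suc zero) = refl
triangular (suc (suc n)) = begin
  -- The term for `zero` vanishes, and each of the remaining `suc n` terms is a successor.
  sum (tabulate {n = suc n} (suc ∘ toℕ)) * 2  ≡⟨ cong (_* 2) (sum-tabulate-suc {suc n} toℕ) ⟩
  (suc n + t) * 2                             ≡⟨ solve 2 (λ n t → ((con 1 :+ n) :+ t) :* con 2 := (con 1 :+ n) :* con 2 :+ t :* con 2) refl n t ⟩
  suc n * 2 + t * 2                           ≡⟨ cong (suc n * 2 +_) (triangular (suc n)) ⟩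
  suc n * 2 + suc n * n                       ≡⟨ solve 1 (λ n → (con 1 :+ n) :* con 2 :+ (con 1 :+ n) :* n := (con 2 :+ n) :* (con 1 :+ n)) refl n ⟩
  suc (suc n) * suc n                         ∎
  where
  open ≡-Reasoning
  open +-*-Solver
  t : ℕ
  t = sum (tabulate {n = suc n} toℕ)

below-total : ∀ n →
  sum (map (λ i → sum (map (λ j → count (toℕ j <ᵇ toℕ i)) (allFin n))) (allFin n)) ≡ choose2 n
below-total n = begin
  sum (map (λ i → sum (map (λ j → count (toℕ j <ᵇ toℕ i)) (allFin n))) (allFin n))
    ≡⟨ cong sum (map-tabulate {n = n} id _) ⟩
  sum (tabulate {n = n} λ i → sum (map (λ j → count (toℕ j <ᵇ toℕ i)) (allFin n)))
    ≡⟨ sum-tabulate-cong {n} (λ i → trans (cong sum (map-tabulate {n = n} id _)) (count-below i)) ⟩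
  sum (tabulate {n = n} toℕ)
    ≡⟨ sym (m*n/n≡m _ 2) ⟩
  _ ≡⟨ /-congˡ (triangular n) ⟩
  choose2 n ∎
  where open ≡-Reasoning

-- Missing edges

Pair : ℕ → Set
Pair n = Fin n × Fin n

-- Larger index first, as in `edgeCount`, so that each missing edge is listed exactly once.
missing : ∀ {n} → Graph n → List (Pair n)
missing {n} G = filterᵇ (λ (i , j) → (toℕ j <ᵇ toℕ i) ∧ not (adj G i j)) (cartesianProduct (allFin n) (allFin n))

edgeCount+missing : ∀ {n} (G : Graph n) → edgeCount G + length (missing G) ≡ choose2 n
edgeCount+missing {n} G =
  trans (table-split (λ i j → toℕ j <ᵇ toℕ i) (adj G) (allFin n) (allFin n)) (below-total n)

missing-unique : ∀ {n} (G : Graph n) → Unique (missing G)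
missing-unique {n} G = filter⁺ _ (cartesianProduct⁺ (allFin⁺ n) (allFin⁺ n))

missing⁻ : ∀ {n} (G : Graph n) {i j} → (i , j) ∈ˡ missing G → toℕ j < toℕ i × adj G i j ≡ false
missing⁻ {n} G {i} {j} m∈ =
  let t = proj₂ (∈-filter⁻ (λ (i , j) → T? ((toℕ j <ᵇ toℕ i) ∧ not (adj G i j))) {xs = cartesianProduct (allFin n) (allFin n)} m∈)
      a , b = Equivalence.to T-∧ t
  in <ᵇ⇒< (toℕ j) (toℕ i) a , Equivalence.to T-not-≡ b

missing⁺ : ∀ {n} (G : Graph n) {i j} → toℕ j < toℕ i → adj G i j ≡ false → (i , j) ∈ˡ missing G
missing⁺ G {i} {j} lt na = ∈-filter⁺ _ (∈-cartesianProduct⁺ (∈-allFin i) (∈-allFin j))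
  (Equivalence.from T-∧ (<⇒<ᵇ lt , Equivalence.from T-not-≡ na))

nonedge∈missing : ∀ {n} (G : Graph n) {x y} → x ≢ y → adj G x y ≡ false →
  (x , y) ∈ˡ missing G ⊎ (y , x) ∈ˡ missing G
nonedge∈missing G {x} {y} x≢y na with <-cmp (toℕ x) (toℕ y)
... | tri< x<y _ _ = inj₂ (missing⁺ G x<y (trans (adj-sym G y x) na))
... | tri≈ _ eq _  = contradiction (toℕ-injective eq) x≢y
... | tri> _ _ y<x = inj₁ (missing⁺ G y<x na)

-- Pairs read without orientation

infix 4 _∈ₑ_

_∈ₑ_ : ∀ {n} → Fin n → Pair n → Set
v ∈ₑ (a , b) = v ≡ a ⊎ v ≡ b

_∈ₑ?_ : ∀ {n} (v : Fin n) e → Dec (v ∈ₑ e)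
v ∈ₑ? (a , b) = v ≟ a ⊎-dec v ≟ b

∈ₑ-third : ∀ {n} {a b v : Fin n} {e} → a ≢ b → a ∈ₑ e → b ∈ₑ e → v ∈ₑ e → v ≡ a ⊎ v ≡ b
∈ₑ-third a≢b (inj₁ p) (inj₁ q) _ = contradiction (trans p (sym q)) a≢b
∈ₑ-third a≢b (inj₂ p) (inj₂ q) _ = contradiction (trans p (sym q)) a≢b
∈ₑ-third a≢b (inj₁ p) (inj₂ q) (inj₁ r) = inj₁ (trans r (sym p))
∈ₑ-third a≢b (inj₁ p) (inj₂ q) (inj₂ r) = inj₂ (trans r (sym q))
∈ₑ-third a≢b (inj₂ p) (inj₁ q) (inj₁ r) = inj₂ (trans r (sym q))
∈ₑ-third a≢b (inj₂ p) (inj₁ q) (inj₂ r) = inj₁ (trans r (sym p))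

Meets : ∀ {n} → Pair n → Pair n → Set
Meets (a , b) f = a ∈ₑ f ⊎ b ∈ₑ f

meets? : ∀ {n} (e f : Pair n) → Dec (Meets e f)
meets? (a , b) f = (a ∈ₑ? f) ⊎-dec (b ∈ₑ? f)

meets : ∀ {n} {v : Fin n} {e f} → v ∈ₑ e → v ∈ₑ f → Meets e f
meets (inj₁ refl) v∈f = inj₁ v∈f
meets (inj₂ refl) v∈f = inj₂ v∈f

meets-sym : ∀ {n} {e f : Pair n} → Meets e f → Meets f e
meets-sym (inj₁ a∈f) = meets a∈f (inj₁ refl)
meets-sym (inj₂ b∈f) = meets b∈f (inj₂ refl)

NonEdge : ∀ {n} → Graph n → Pair n → Set
NonEdge G (x , y) = x ≢ y × adj G x y ≡ false

-- Only an upper bound on the set of missing edges: orientation, order and repetitions in `es` do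
-- not matter, so the list may be permuted or padded freely.
Covers : ∀ {n} → Graph n → List (Pair n) → Set
Covers G es = ∀ x y → x ≢ y → adj G x y ≡ false → Any (λ e → x ∈ₑ e × y ∈ₑ e) es

missing-covers : ∀ {n} (G : Graph n) → Covers G (missing G)
missing-covers G x y x≢y na with nonedge∈missing G x≢y na
... | inj₁ m∈ = Any.map (λ { refl → inj₁ refl , inj₂ refl }) m∈
... | inj₂ m∈ = Any.map (λ { refl → inj₂ refl , inj₁ refl }) m∈

missing-nonedges : ∀ {n} (G : Graph n) → All (NonEdge G) (missing G)
missing-nonedges G = All.tabulate λ {(i , j)} m∈ → let j<i , na = missing⁻ G m∈ in
  (λ { refl → <-irrefl refl j<i }) , na

covers-resp-↭ : ∀ {n} {G : Graph n} {es fs} → es ↭ fs → Covers G es → Covers G fs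
covers-resp-↭ p cov x y x≢y na = Any-resp-↭ p (cov x y x≢y na)

-- MVD-colourings

surjective : ∀ {n m} {c : Fin n → Fin m} → (∀ j → ∃ λ v → c v ≡ j) → Surjective _≡_ _≡_ c
surjective h j = let v , eq = h j in v , λ { refl → eq }

-- `vs` contains a vertex of every colour that occurs, and by surjectivity all `m` colours occur.
colours≤ : ∀ {n m} {c : Fin n → Fin m} → Surjective _≡_ _≡_ c → (vs : List (Fin n)) →
  (∀ v → Any (λ u → c v ≡ c u) vs) → m ≤ length vs
colours≤ {c = c} sur vs cov = ≤-trans (covering-length (map c vs) all∈) (≤-reflexive (length-map c vs))
  where
  all∈ : ∀ j → j ∈ˡ map c vs
  all∈ j with sur j
  ... | v , eq with Any.map (trans (sym (eq refl))) (cov v)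
  ... | p = map∈ p
    where
    map∈ : ∀ {us} → Any (λ u → j ≡ c u) us → j ∈ˡ map c us
    map∈ (here q)  = here q
    map∈ (there q) = there (map∈ q)

-- A common neighbour left out of the cut would give a path of length two from `x` to `y`. Hence
-- every cut contains all common neighbours, and a monochromatic one forces them to agree.
common-neighbours-mono : ∀ {n m} (G : Graph n) {c : Fin n → Fin m} → IsMVDColoring G c →
  ∀ {x y u v} → NonEdge G (x , y) →
  adj G x u ≡ true → adj G y u ≡ true → adj G x v ≡ true → adj G y v ≡ true → c u ≡ c v
common-neighbours-mono G mvd {x} {y} {u} {v} (x≢y , na) xu yu xv yv
  with S , (x∉ , y∉ , cut) , mono ← mvd x y x≢y na = mono u v (inS xu yu) (inS xv yv)
  where
  inS : ∀ {w} → adj G x w ≡ true → adj G y w ≡ true → w ∈ S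
  inS {w} xw yw with w ∈? S
  ... | yes w∈ = w∈
  ... | no w∉  = contradiction (step x∉ xw (step w∉ (trans (adj-sym G w y) yw) (here y∉))) cut

NbhdMono : ∀ {n m} → Graph n → (Fin n → Fin m) → Fin n → Set
NbhdMono G c x = ∀ u v → adj G x u ≡ true → adj G x v ≡ true → c u ≡ c v

-- Neighbourhoods as vertex cuts

module _ {n} (G : Graph n) where

  nbhd : Fin n → Subset n
  nbhd x = tabulateᵛ (adj G x)

  nbhd⁺ : ∀ {x v} → adj G x v ≡ true → v ∈ nbhd x
  nbhd⁺ {x} {v} xv = lookup⇒[]= v _ (trans (lookup∘tabulate (adj G x) v) xv)

  nbhd⁻ : ∀ {x v} → v ∈ nbhd x → adj G x v ≡ true
  nbhd⁻ {x} {v} v∈ = trans (sym (lookup∘tabulate (adj G x) v)) ([]=⇒lookup v∈)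

  ∉nbhd : ∀ {x v} → adj G x v ≡ false → v ∉ nbhd x
  ∉nbhd na v∈ = contradiction (trans (sym na) (nbhd⁻ v∈)) λ ()

  ends-beyond-nbhd : ∀ {x y} → x ≢ y → ¬ Path G (_∉ nbhd y) x y
  ends-beyond-nbhd x≢y (here _) = x≢y refl
  ends-beyond-nbhd {x} {y} x≢y (step {y = z} x∉ xz p) with z ≟ y
  ... | yes refl = x∉ (nbhd⁺ (trans (adj-sym G y x) xz))
  ... | no z≢y   = ends-beyond-nbhd z≢y p

  starts-beyond-nbhd : ∀ {x y} → x ≢ y → ¬ Path G (_∉ nbhd x) x y
  starts-beyond-nbhd x≢y (here _)                      = x≢y refl
  starts-beyond-nbhd x≢y (step _ xz (here z∉))         = z∉ (nbhd⁺ xz)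
  starts-beyond-nbhd x≢y (step _ xz (step z∉ _ _))     = z∉ (nbhd⁺ xz)

  -- The neighbourhood of a vertex separates it from every other vertex not adjacent to it, so a
  -- monochromatic neighbourhood of either end serves as the cut.
  nbhdMono⇒MVD : ∀ {m} {c : Fin n → Fin m} →
    (∀ x y → x ≢ y → adj G x y ≡ false → NbhdMono G c x ⊎ NbhdMono G c y) → IsMVDColoring G c
  nbhdMono⇒MVD h x y x≢y na with h x y x≢y na
  ... | inj₁ mono = nbhd x
      , (∉nbhd (irrefl G x) , ∉nbhd na , starts-beyond-nbhd x≢y)
      , λ u v u∈ v∈ → mono u v (nbhd⁻ u∈) (nbhd⁻ v∈)
  ... | inj₂ mono = nbhd y
      , (∉nbhd (trans (adj-sym G y x) na) , ∉nbhd (irrefl G y) , ends-beyond-nbhd x≢y)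
      , λ u v u∈ v∈ → mono u v (nbhd⁻ u∈) (nbhd⁻ v∈)

-- Every vertex v outside {x , y} is a common neighbour of x and y, or misses one of them;
-- in the second case v is recovered from that missing pair as its other end.
colours≤2+missing : ∀ {n m} (G : Graph n) {c : Fin n → Fin m} → Surjective _≡_ _≡_ c → IsMVDColoring G c →
  ∀ {x y} → NonEdge G (x , y) → m ≤ 2 + length (missing G)
colours≤2+missing {n} G {c} sur mvd {x} {y} (x≢y , na) =
  -- `w` stands for all common neighbours. The vertex `y` takes no entry of its own: it is the other
  -- end of the missing pair {x , y}.
  ≤-trans (colours≤ sur (w ∷ x ∷ map other (missing G)) represented) (≤-reflexive (cong (2 +_) (length-map other (missing G))))
  where
  Common : Fin n → Set
  Common v = adj G x v ≡ true × adj G y v ≡ true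

  common? : ∀ v → Dec (Common v)
  common? v = (adj G x v ≟ᵇ true) ×-dec (adj G y v ≟ᵇ true)

  common-colour : Σ (Fin n) λ w → ∀ v → Common v → c v ≡ c w
  common-colour with any? common?
  ... | yes (w , xw , yw) = w , λ v (xv , yv) → common-neighbours-mono G mvd (x≢y , na) xv yv xw yw
  -- Default value: without common neighbours the claim about `w` is vacuous.
  ... | no none           = x , λ v cv → contradiction (v , cv) none

  w : Fin n
  w = proj₁ common-colour

  -- The tests for `x` precede the test for `y`, so {x , y} yields `y` in both orientations. On
  -- pairs avoiding both vertices the value is arbitrary.
  other : Pair n → Fin n
  other (i , j) = if does (i ≟ x) then j else if does (j ≟ x) then i else if does (i ≟ y) then j else i

  other-x : ∀ {v} → v ≢ x → other (x , v) ≡ v × other (v , x) ≡ v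
  other-x {v} v≢x rewrite dec-true (x ≟ x) refl | dec-false (v ≟ x) v≢x = refl , refl

  other-y : ∀ {v} → v ≢ x → v ≢ y → other (y , v) ≡ v × other (v , y) ≡ v
  other-y {v} v≢x v≢y
    rewrite dec-false (v ≟ x) v≢x | dec-false (y ≟ x) (x≢y ∘ sym) | dec-true (y ≟ y) refl | dec-false (v ≟ y) v≢y
    = refl , refl

  far : ∀ {z v} → z ≢ v → adj G z v ≡ false → other (z , v) ≡ v × other (v , z) ≡ v →
    Any (λ u → c v ≡ c u) (map other (missing G))
  far z≢v nzv (p , q) with nonedge∈missing G z≢v nzv
  ... | inj₁ m∈ = Any.map (λ eq → cong c (trans (sym p) eq)) (∈-map⁺ other m∈)
  ... | inj₂ m∈ = Any.map (λ eq → cong c (trans (sym q) eq)) (∈-map⁺ other m∈)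

  represented : ∀ v → Any (λ u → c v ≡ c u) (w ∷ x ∷ map other (missing G))
  represented v with v ≟ x
  ... | yes refl = there (here refl)
  ... | no v≢x with adj G x v in xv
  ...   | false = there (there (far (v≢x ∘ sym) xv (other-x v≢x)))
  ...   | true with adj G y v in yv
  ...     | true  = here (proj₂ common-colour v (xv , yv))
  ...     | false with v ≟ y
  ...       | yes refl = contradiction (trans (sym na) xv) λ ()
  ...       | no v≢y   = there (there (far (v≢y ∘ sym) yv (other-y v≢x v≢y)))

-- Without nonadjacent pairs the MVD condition is vacuous, so all vertices may differ in colour.
complete-colouring : ∀ {n} (G : Graph n) → Covers G [] →
  Surjective _≡_ _≡_ (id {A = Fin n}) × IsMVDColoring G id
complete-colouring G cov = surjective (λ j → j , refl) ,
  λ x y x≢y na → case cov x y x≢y na of λ ()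

-- If {b , d} is a missing pair that meets every missing pair, then b and d may receive private colours:
-- N(b) and N(d) avoid both, and every missing pair is separated by one of these neighbourhoods.
dominating-colouring : ∀ {n} (G : Graph n) {e es} → 2 < n → NonEdge G e → Covers G es → All (Meets e) es →
  Σ (Fin n → Fin 3) λ c → Surjective _≡_ _≡_ c × IsMVDColoring G c
dominating-colouring {n} G {b , d} {es} 2<n (b≢d , na) cov dom = col , surjective onto , nbhdMono⇒MVD G separated
  where
  col : Fin n → Fin 3
  col v = if does (v ≟ b) then 1F else if does (v ≟ d) then 2F else 0F

  col-else : ∀ {v} → v ≢ b → v ≢ d → col v ≡ 0F
  col-else {v} v≢b v≢d rewrite dec-false (v ≟ b) v≢b | dec-false (v ≟ d) v≢d = refl

  onto : ∀ j → ∃ λ v → col v ≡ j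
  -- A third vertex, available since `2 < n`, carries the common colour.
  onto 0F = let v , v∉ = fresh (b ∷ d ∷ []) 2<n in v , col-else (v∉ ∘ here) (v∉ ∘ there ∘ here)
  onto 1F = b , b-col
    where
    b-col : col b ≡ 1F
    b-col rewrite dec-true (b ≟ b) refl = refl
  onto 2F = d , d-col
    where
    d-col : col d ≡ 2F
    d-col rewrite dec-false (d ≟ b) (b≢d ∘ sym) | dec-true (d ≟ d) refl = refl

  clash : ∀ {z u v} → adj G z u ≡ false → adj G z v ≡ true → v ≢ u
  clash zu zv refl = contradiction (trans (sym zu) zv) λ ()

  mono : ∀ {z} → z ∈ₑ (b , d) → NbhdMono G col z
  mono z∈ u v zu zv = trans (zero-on z∈ zu) (sym (zero-on z∈ zv))
    where
    zero-on : ∀ {z v} → z ∈ₑ (b , d) → adj G z v ≡ true → col v ≡ 0F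
    zero-on (inj₁ refl) zv = col-else (clash (irrefl G b) zv) (clash na zv)
    zero-on (inj₂ refl) zv = col-else (clash (trans (adj-sym G d b) na) zv) (clash (irrefl G d) zv)

  separated : ∀ x y → x ≢ y → adj G x y ≡ false → NbhdMono G col x ⊎ NbhdMono G col y
  separated x y x≢y nxy = go dom (cov x y x≢y nxy)
    where
    go : ∀ {fs} → All (Meets (b , d)) fs → Any (λ f → x ∈ₑ f × y ∈ₑ f) fs → NbhdMono G col x ⊎ NbhdMono G col y
    -- The ends of this pair are `x` and `y`, so the end that it shares with {b , d} is one of them.
    go (inj₁ b∈f ∷ _) (here (x∈ , y∈)) with ∈ₑ-third x≢y x∈ y∈ b∈f
    ... | inj₁ refl = inj₁ (mono (inj₁ refl))
    ... | inj₂ refl = inj₂ (mono (inj₁ refl))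
    go (inj₂ d∈f ∷ _) (here (x∈ , y∈)) with ∈ₑ-third x≢y x∈ y∈ d∈f
    ... | inj₁ refl = inj₁ (mono (inj₂ refl))
    ... | inj₂ refl = inj₂ (mono (inj₂ refl))
    go (_ ∷ ms) (there p) = go ms p

constant⇒≤1 : ∀ {n m} {c : Fin n → Fin m} → Surjective _≡_ _≡_ c → ∀ u → (∀ v → c v ≡ c u) → m ≤ 1
constant⇒≤1 sur u h = colours≤ sur (u ∷ []) λ v → here (h v)

-- All vertices outside e are common neighbours of e, and the ends of e and u are common neighbours of g.
isolated⇒≤1 : ∀ {n m} (G : Graph n) {c : Fin n → Fin m} → Surjective _≡_ _≡_ c → IsMVDColoring G c →
  ∀ {e g h u} → NonEdge G e → NonEdge G g → Covers G (e ∷ g ∷ h ∷ []) →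
  ¬ Meets e g → ¬ Meets e h → ¬ u ∈ₑ e → ¬ u ∈ₑ g → ¬ (u ∈ₑ h × Meets g h) → m ≤ 1
isolated⇒≤1 {n} G {c} sur mvd {e@(x , y)} {g@(z , w)} {h} {u} ne ng cov e#g e#h u∉e u∉g u∉h =
  constant⇒≤1 sur u same
  where
  e-joined : ∀ {a v} → a ∈ₑ e → ¬ v ∈ₑ e → adj G a v ≡ true
  e-joined {a} {v} a∈ v∉ with adj G a v in av
  ... | true = refl
  ... | false with cov a v (λ { refl → v∉ a∈ }) av
  ...   | here (_ , v∈)                  = contradiction v∈ v∉
  ...   | there (here (a∈g , _))         = contradiction (meets a∈ a∈g) e#g
  ...   | there (there (here (a∈h , _))) = contradiction (meets a∈ a∈h) e#h

  u-joined : ∀ {a} → a ∈ₑ g → adj G a u ≡ true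
  u-joined {a} a∈ with adj G a u in au
  ... | true = refl
  ... | false with cov a u (λ { refl → u∉g a∈ }) au
  ...   | here (_ , u∈)                    = contradiction u∈ u∉e
  ...   | there (here (_ , u∈))            = contradiction u∈ u∉g
  -- Only `h` can still account for a missing edge from `u` to `g`; it would then contain `u` and an
  -- end of `g`, which the last hypothesis excludes.
  ...   | there (there (here (a∈h , u∈h))) = contradiction (u∈h , meets a∈ a∈h) u∉h

  g-joined : ∀ {a v} → a ∈ₑ g → v ∈ₑ e → adj G a v ≡ true
  g-joined {a} {v} a∈ v∈ = trans (adj-sym G a v) (e-joined v∈ λ a∈e → e#g (meets a∈e a∈))

  same : ∀ v → c v ≡ c u
  same v with v ∈ₑ? e
  ... | yes v∈ = common-neighbours-mono G mvd ng
      (g-joined (inj₁ refl) v∈) (g-joined (inj₂ refl) v∈) (u-joined (inj₁ refl)) (u-joined (inj₂ refl))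
  ... | no v∉  = common-neighbours-mono G mvd ne
      (e-joined (inj₁ refl) v∉) (e-joined (inj₂ refl) v∉) (e-joined (inj₁ refl) u∉e) (e-joined (inj₂ refl) u∉e)

-- Lets `isolated⇒≤1`, stated for three pairs, handle two missing edges by taking `h` equal to `g`.
covers-duplicate : ∀ {n} {G : Graph n} {e g} → Covers G (e ∷ g ∷ []) → Covers G (e ∷ g ∷ g ∷ [])
covers-duplicate cov x y x≢y na = ++⁺ˡ (cov x y x≢y na)

-- Graphs with few missing edges

∉ˡ⇒∉ₑ : ∀ {n} {v a b : Fin n} {vs} → v ∉ˡ (a ∷ b ∷ vs) → ¬ v ∈ₑ (a , b)
∉ˡ⇒∉ₑ v∉ (inj₁ refl) = v∉ (here refl)
∉ˡ⇒∉ₑ v∉ (inj₂ refl) = v∉ (there (here refl))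

complete-or-nonedge : ∀ {n} (G : Graph n) → Covers G [] ⊎ ∃ (NonEdge G)
complete-or-nonedge G = go (missing-covers G) (missing-nonedges G)
  where
  go : ∀ {es} → Covers G es → All (NonEdge G) es → Covers G [] ⊎ ∃ (NonEdge G)
  go cov []       = inj₁ cov
  go cov (ne ∷ _) = inj₂ (_ , ne)

-- A complete graph admits `n` colours, so `k < n` guarantees a nonadjacent pair to which
-- `colours≤2+missing` applies.
mvd<n⇒≤2+missing : ∀ {n k} (G : Graph n) → k < n → MvdIs G k → k ≤ 2 + length (missing G)
mvd<n⇒≤2+missing G k<n ((c , sur , mvd) , max) with complete-or-nonedge G
... | inj₂ (_ , ne) = colours≤2+missing G sur mvd ne
... | inj₁ cov = let sur′ , mvd′ = complete-colouring G cov in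
  contradiction (≤-trans k<n (max _ id sur′ mvd′)) (<-irrefl refl)

-- No missing edge allows `n` colours, and a single one meets every missing edge, which allows
-- three; both exceed one.
mvd1⇒2≤missing : ∀ {n} (G : Graph n) → 2 < n → MvdIs G 1 → 2 ≤ length (missing G)
mvd1⇒2≤missing {n} G 2<n (_ , max) = go (missing-covers G) (missing-nonedges G)
  where
  go : ∀ {es} → Covers G es → All (NonEdge G) es → 2 ≤ length es
  go cov [] = let sur , mvd = complete-colouring G cov in
    contradiction (≤-trans 2<n (max n id sur mvd)) λ { (s≤s ()) }
  go cov (ne ∷ []) = let c , sur , mvd = dominating-colouring G 2<n ne cov (inj₁ (inj₁ refl) ∷ []) in
    contradiction (max 3 c sur mvd) λ { (s≤s ()) }
  go cov (_ ∷ _ ∷ _) = s≤s (s≤s z≤n)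

-- Missing edges of graphs with mvd equal to 2

module _ {n} (G : Graph n) (4<n : 4 < n) (mvd2 : MvdIs G 2) where

  private
    2<n : 2 < n
    2<n = ≤-trans (s≤s (s≤s (s≤s z≤n))) 4<n

  not-complete : ¬ Covers G []
  not-complete cov = let sur , mvd = complete-colouring G cov in
    contradiction (≤-trans 2<n (proj₂ mvd2 n id sur mvd)) λ { (s≤s (s≤s ())) }

  not-dominated : ∀ {e es} → NonEdge G e → Covers G es → ¬ All (Meets e) es
  not-dominated ne cov dom = let c , sur , mvd = dominating-colouring G 2<n ne cov dom in
    contradiction (proj₂ mvd2 3 c sur mvd) λ { (s≤s (s≤s ())) }

  not-isolated : ∀ {e g h u} → NonEdge G e → NonEdge G g → Covers G (e ∷ g ∷ h ∷ []) →
    ¬ Meets e g → ¬ Meets e h → ¬ u ∈ₑ e → ¬ u ∈ₑ g → ¬ ¬ (u ∈ₑ h × Meets g h)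
  not-isolated ne ng cov e#g e#h u∉e u∉g u∉h = let c , sur , mvd = proj₁ mvd2 in
    contradiction (isolated⇒≤1 G sur mvd ne ng cov e#g e#h u∉e u∉g u∉h) λ { (s≤s ()) }

  -- Two missing edges either meet, so that one of them meets all and three colours are possible, or
  -- are disjoint, so that with a vertex off both only one colour is possible.
  at-least-3 : ∀ {es} → Covers G es → All (NonEdge G) es → 3 ≤ length es
  at-least-3 cov [] = contradiction cov not-complete
  at-least-3 cov (ne ∷ []) = contradiction (inj₁ (inj₁ refl) ∷ []) (not-dominated ne cov)
  at-least-3 {e ∷ f ∷ []} cov (ne ∷ nf ∷ []) with meets? e f
  ... | yes m = contradiction (inj₁ (inj₁ refl) ∷ m ∷ []) (not-dominated ne cov)
  ... | no e#f =
    let u , u∉ = fresh (proj₁ e ∷ proj₂ e ∷ proj₁ f ∷ proj₂ f ∷ []) 4<n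
        u∉f = ∉ˡ⇒∉ₑ (u∉ ∘ there ∘ there)
    in contradiction (λ (u∈f , _) → u∉f u∈f)
         (not-isolated ne nf (covers-duplicate {G = G} cov) e#f e#f (∉ˡ⇒∉ₑ u∉) u∉f)
  at-least-3 cov (_ ∷ _ ∷ _ ∷ _) = s≤s (s≤s (s≤s z≤n))

  -- For one of two vertices u, v outside e and g, `not-isolated` applies:
  -- otherwise h would contain u, v and an end of g.
  no-isolated-among-3 : ∀ {e g h} → 5 < n → NonEdge G e → NonEdge G g → Covers G (e ∷ g ∷ h ∷ []) →
    ¬ Meets e g → Meets e h
  no-isolated-among-3 {e} {g} {h} 5<n ne ng cov e#g with meets? e h
  ... | yes m = m
  ... | no e#h with fresh (proj₁ e ∷ proj₂ e ∷ proj₁ g ∷ proj₂ g ∷ []) 4<n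
  ...   | u , u∉ with fresh (proj₁ e ∷ proj₂ e ∷ proj₁ g ∷ proj₂ g ∷ u ∷ []) 5<n
  ...     | v , v∉ = contradiction (λ (v∈h , _) → u-bad λ (u∈h , g~h) → g∉uv (third u∈h v∈h g~h)) v-bad
    where
    u∉g : ¬ u ∈ₑ g
    u∉g = ∉ˡ⇒∉ₑ (u∉ ∘ there ∘ there)
    v∉g : ¬ v ∈ₑ g
    v∉g = ∉ˡ⇒∉ₑ (v∉ ∘ there ∘ there)
    v-bad : ¬ ¬ (v ∈ₑ h × Meets g h)
    v-bad = not-isolated ne ng cov e#g e#h (∉ˡ⇒∉ₑ v∉) v∉g
    u-bad : ¬ ¬ (u ∈ₑ h × Meets g h)
    u-bad = not-isolated ne ng cov e#g e#h (∉ˡ⇒∉ₑ u∉) u∉g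
    u≢v : u ≢ v
    u≢v refl = v∉ (there (there (there (there (here refl)))))
    third : u ∈ₑ h → v ∈ₑ h → Meets g h → Meets g (u , v)
    third u∈h v∈h (inj₁ a) = inj₁ (∈ₑ-third u≢v u∈h v∈h a)
    third u∈h v∈h (inj₂ a) = inj₂ (∈ₑ-third u≢v u∈h v∈h a)
    g∉uv : ¬ Meets g (u , v)
    g∉uv m with meets-sym m
    ... | inj₁ u∈ = u∉g u∈
    ... | inj₂ v∈ = v∉g v∈

  -- Among three pairs, either one meets both others or one is disjoint from both others. The first
  -- allows three colours; the second is ruled out by `no-isolated-among-3`.
  at-least-4 : ∀ {es} → 5 < n → Covers G es → All (NonEdge G) es → 4 ≤ length es
  at-least-4 {e ∷ f ∷ g ∷ []} 5<n cov (ne ∷ nf ∷ ng ∷ []) = ⊥-elim (absurd (meets? e f) (meets? e g) (meets? f g))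
    where
    reflₘ : ∀ {e : Pair n} → Meets e e
    reflₘ = inj₁ (inj₁ refl)
    cov-f : Covers G (f ∷ e ∷ g ∷ [])
    cov-f = covers-resp-↭ {G = G} (swap e f ↭-refl) cov
    cov-g : Covers G (g ∷ f ∷ e ∷ [])
    cov-g = covers-resp-↭ {G = G} (↭-trans (prep f (swap e g ↭-refl)) (swap f g ↭-refl)) cov-f
    absurd : Dec (Meets e f) → Dec (Meets e g) → Dec (Meets f g) → ⊥
    absurd (yes ef) (yes eg) _ = not-dominated ne cov (reflₘ ∷ ef ∷ eg ∷ [])
    absurd (yes ef) _ (yes fg) = not-dominated nf cov (meets-sym ef ∷ reflₘ ∷ fg ∷ [])
    absurd _ (yes eg) (yes fg) = not-dominated ng cov (meets-sym eg ∷ meets-sym fg ∷ reflₘ ∷ [])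
    -- From here on some pair is disjoint from the other two.
    absurd (no ef) (no eg) _ = eg (no-isolated-among-3 5<n ne nf cov ef)
    absurd (no ef) _ (no fg) = fg (no-isolated-among-3 5<n nf ne cov-f (ef ∘ meets-sym))
    absurd _ (no eg) (no fg) = eg (meets-sym (no-isolated-among-3 5<n ng nf cov-g (fg ∘ meets-sym)))
  at-least-4 {_ ∷ _ ∷ _ ∷ _ ∷ _} _ _ _ = s≤s (s≤s (s≤s (s≤s z≤n)))
  at-least-4 {[]} _ cov ns with () ← at-least-3 cov ns
  at-least-4 {_ ∷ []} _ cov ns with s≤s () ← at-least-3 cov ns
  at-least-4 {_ ∷ _ ∷ []} _ cov ns with s≤s (s≤s ()) ← at-least-3 cov ns

-- Complements of small graphs

module _ {n} (es : List (Pair n)) where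

  -- Equality makes the complement loopless; listing both orientations makes it symmetric.
  NotJoined : Fin n → Fin n → Set
  NotJoined i j = i ≡ j ⊎ ((i , j) ∈ˡ es ⊎ (j , i) ∈ˡ es)

  notJoined? : ∀ i j → Dec (NotJoined i j)
  notJoined? i j = i ≟ j ⊎-dec (member? (i , j) ⊎-dec member? (j , i))
    where
    member? : ∀ e → Dec (e ∈ˡ es)
    member? e = Any.any? (≡-dec _≟_ _≟_ e) es

  coGraph : Graph n
  coGraph = record
    { adj    = λ i j → not (does (notJoined? i j))
    ; sym    = λ i j → cong not (does-⇔ (mk⇔ flip flip) (notJoined? i j) (notJoined? j i))
    ; irrefl = λ i → cong not (dec-true (notJoined? i i) (inj₁ refl))
    }
    where
    flip : ∀ {i j} → NotJoined i j → NotJoined j i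
    flip = map⊎ sym swap⊎

  co-nonadj : ∀ {i j} → (i , j) ∈ˡ es → adj coGraph i j ≡ false
  co-nonadj {i} {j} m = cong not (dec-true (notJoined? i j) (inj₂ (inj₁ m)))

  co-adj : ∀ {i j} → ¬ NotJoined i j → adj coGraph i j ≡ true
  co-adj {i} {j} nj = cong not (dec-false (notJoined? i j) nj)

  co-nonedge : ∀ {i j} → i ≢ j → adj coGraph i j ≡ false → (i , j) ∈ˡ es ⊎ (j , i) ∈ˡ es
  co-nonedge {i} {j} i≢j na with notJoined? i j
  ... | yes (inj₁ eq) = contradiction eq i≢j
  ... | yes (inj₂ m)  = m
  ... | no nj         = contradiction (trans (sym na) (co-adj nj)) λ ()

  co-covers : Covers coGraph es
  co-covers x y x≢y na with co-nonedge x≢y na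
  ... | inj₁ m = Any.map (λ { refl → inj₁ refl , inj₂ refl }) m
  ... | inj₂ m = Any.map (λ { refl → inj₂ refl , inj₁ refl }) m

  co-MVD : ∀ {m} {c : Fin n → Fin m} →
    All (λ (i , j) → NbhdMono coGraph c i ⊎ NbhdMono coGraph c j) es → IsMVDColoring coGraph c
  co-MVD monos = nbhdMono⇒MVD coGraph λ x y x≢y na → case co-nonedge x≢y na of λ
    { (inj₁ m) → All.lookup monos m ; (inj₂ m) → swap⊎ (All.lookup monos m) }

  Ordered : Set
  Ordered = All (λ (i , j) → toℕ j < toℕ i) es

  -- `missing` is free of repetitions, and since `es` follows its orientation, every missing pair
  -- occurs literally in `es`.
  missing-co≤ : Ordered → length (missing coGraph) ≤ length es
  missing-co≤ ord = unique-⊆⇒length≤ (missing-unique coGraph) λ {(i , j)} m∈ →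
    let j<i , na = missing⁻ coGraph m∈ in
    case co-nonedge (λ { refl → <-irrefl refl j<i }) na of λ
      { (inj₁ m) → m ; (inj₂ m) → contradiction (All.lookup ord m) (<-asym j<i) }

  -- The general upper bound applies to the example itself, so it remains to show that the example
  -- has at least `M` edges; for this a bound on its missing edges from above suffices.
  extremal : ∀ {k M} → Ordered → Connected coGraph → MvdIs coGraph k → M + length es ≤ choose2 n →
    (∀ (G : Graph n) → MvdIs G k → edgeCount G ≤ M) → MaxEdges n k M
  extremal {k} {M} ord con mvd low up =
    (coGraph , con , mvd , ≤-antisym (up coGraph mvd) M≤) , λ G _ → up G
    where
    open ≤-Reasoning
    M≤ : M ≤ edgeCount coGraph
    M≤ = +-cancelʳ-≤ (length es) M (edgeCount coGraph) (begin
      M + length es                                  ≤⟨ low ⟩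
      choose2 n                                      ≡⟨ sym (edgeCount+missing coGraph) ⟩
      edgeCount coGraph + length (missing coGraph)   ≤⟨ +-monoʳ-≤ (edgeCount coGraph) (missing-co≤ ord) ⟩
      edgeCount coGraph + length es                  ∎)

-- Connectivity and arithmetic for the examples

hub-connected : ∀ {n} (G : Graph n) w → (∀ v → Path G (λ _ → ⊤) v w) → Connected G
hub-connected G w to x y = append (to x) (reverse (here tt) (to y))
  where
  append : ∀ {a b d} → Path G (λ _ → ⊤) a b → Path G (λ _ → ⊤) b d → Path G (λ _ → ⊤) a d
  append (here _)     q = q
  append (step t e p) q = step t e (append p q)
  reverse : ∀ {a b d} → Path G (λ _ → ⊤) a d → Path G (λ _ → ⊤) a b → Path G (λ _ → ⊤) b d
  reverse acc (here _)                  = acc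
  reverse acc (step {x} {y} _ e p) = reverse (step tt (trans (adj-sym G y x) e) acc) p

universal-connected : ∀ {n} (G : Graph n) w → (∀ v → v ≢ w → adj G v w ≡ true) → Connected G
universal-connected G w joined = hub-connected G w to
  where
  to : ∀ v → Path G (λ _ → ⊤) v w
  to v with v ≟ w
  ... | yes refl = here tt
  ... | no v≢w   = step tt (joined v v≢w) (here tt)

edgeCount≤ : ∀ {n t} (G : Graph n) → t ≤ length (missing G) → edgeCount G ≤ choose2 n ∸ t
edgeCount≤ {n} {t} G t≤ = begin
  edgeCount G                                             ≡⟨ sym (m+n∸n≡m (edgeCount G) (length (missing G))) ⟩
  edgeCount G + length (missing G) ∸ length (missing G)   ≡⟨ cong (_∸ length (missing G)) (edgeCount+missing G) ⟩
  choose2 n ∸ length (missing G)                          ≤⟨ ∸-monoʳ-≤ (choose2 n) t≤ ⟩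
  choose2 n ∸ t                                           ∎
  where open ≤-Reasoning

-- Here `n ∸ 1` is at least 2. The bound keeps the truncated subtractions in the extremal sizes
-- exact.
n≤choose2 : ∀ {n} → 3 ≤ n → n ≤ choose2 n
n≤choose2 {n} 3≤n = begin
  n               ≡⟨ sym (m*n/n≡m n 2) ⟩
  (n * 2) / 2     ≤⟨ /-monoˡ-≤ 2 (*-monoʳ-≤ n (∸-monoˡ-≤ 1 3≤n)) ⟩
  choose2 n       ∎
  where open ≤-Reasoning

∸+≤ : ∀ {n t} → t ≤ n → n ∸ t + t ≤ n
∸+≤ t≤n = ≤-reflexive (m∸n+n≡m t≤n)

-- Extremal graphs

const-MVD : ∀ {n} (G : Graph n) → IsMVDColoring {m = 1} G (const 0F)
const-MVD G = nbhdMono⇒MVD G λ _ _ _ _ → inj₁ λ _ _ _ _ → refl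

-- Extremal graph: the complement of two disjoint edges.
maxEdges-1 : ∀ m → let n = 5 + m in MaxEdges n 1 (choose2 n ∸ 2)
maxEdges-1 m = extremal es (s≤s z≤n ∷ s≤s (s≤s (s≤s z≤n)) ∷ []) (universal-connected G 4F joined)
  ((const 0F , surjective {m = 1} (λ { 0F → 0F , refl }) , const-MVD G) , max)
  (∸+≤ (≤-trans (s≤s (s≤s z≤n)) (n≤choose2 {n} (s≤s (s≤s (s≤s z≤n))))))
  (λ H mvd → edgeCount≤ H (mvd1⇒2≤missing H (s≤s (s≤s (s≤s z≤n))) mvd))
  where
  n : ℕ
  n = 5 + m
  es : List (Pair n)
  es = (1F , 0F) ∷ (3F , 2F) ∷ []
  G : Graph n
  G = coGraph es
  joined : ∀ v → v ≢ 4F → adj G v 4F ≡ true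
  joined 0F _ = refl
  joined 1F _ = refl
  joined 2F _ = refl
  joined 3F _ = refl
  joined 4F v≢ = contradiction refl v≢
  joined (suc (suc (suc (suc (suc v))))) _ = refl
  max : ∀ k (c : Fin n → Fin k) → Surjective _≡_ _≡_ c → IsMVDColoring G c → k ≤ 1
  -- The second missing edge is repeated as `h`, and vertex 4 lies off both.
  max k c sur mvd = isolated⇒≤1 G sur mvd {1F , 0F} {3F , 2F} {3F , 2F} {4F}
    ((λ ()) , refl) ((λ ()) , refl) (covers-duplicate {G = G} (co-covers es))
    e#g e#g (λ { (inj₁ ()) ; (inj₂ ()) }) u∉g (λ (u∈ , _) → u∉g u∈)
    where
    e#g : ¬ Meets {n} (1F , 0F) (3F , 2F)
    e#g (inj₁ (inj₁ ()))
    e#g (inj₁ (inj₂ ()))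
    e#g (inj₂ (inj₁ ()))
    e#g (inj₂ (inj₂ ()))
    u∉g : ¬ _∈ₑ_ {n} 4F (3F , 2F)
    u∉g (inj₁ ())
    u∉g (inj₂ ())

-- Extremal graph: the complement of the disjoint union of a path on 3 vertices and an edge.
maxEdges-2-5 : MaxEdges 5 2 7
maxEdges-2-5 = extremal es (s≤s z≤n ∷ s≤s (s≤s z≤n) ∷ s≤s (s≤s (s≤s (s≤s z≤n))) ∷ []) (hub-connected G 3F to)
  ((col , surjective (λ { 0F → 0F , refl ; 1F → 3F , refl })
        , co-MVD es (inj₁ mono-1 ∷ inj₂ mono-1 ∷ inj₂ mono-3 ∷ []))
  , max)
  ≤-refl
  -- Four missing edges cannot be forced on five vertices: here the only vertex off {3 , 4} and {0 ,
  -- 1} is 2, and it lies on {1 , 2}.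
  (λ H mvd → edgeCount≤ H (at-least-3 H ≤-refl mvd (missing-covers H) (missing-nonedges H)))
  where
  es : List (Pair 5)
  es = (1F , 0F) ∷ (2F , 1F) ∷ (4F , 3F) ∷ []
  G : Graph 5
  G = coGraph es
  to : ∀ v → Path G (λ _ → ⊤) v 3F
  to 0F = step tt refl (here tt)
  to 1F = step tt refl (here tt)
  to 2F = step tt refl (here tt)
  to 3F = here tt
  -- 3 and 4 are not adjacent, so the path goes through 0.
  to 4F = step {y = 0F} tt refl (step tt refl (here tt))
  -- The classes {0 , 1 , 2} and {3 , 4} are the neighbourhoods of 3 and of 1, and every missing
  -- edge contains 1 or 3.
  col : Fin 5 → Fin 2
  col 3F = 1F
  col 4F = 1F
  col _  = 0F
  on-1 : ∀ v → adj G 1F v ≡ true → col v ≡ 1F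
  on-1 0F ()
  on-1 1F ()
  on-1 2F ()
  on-1 3F _ = refl
  on-1 4F _ = refl
  on-3 : ∀ v → adj G 3F v ≡ true → col v ≡ 0F
  on-3 0F _ = refl
  on-3 1F _ = refl
  on-3 2F _ = refl
  on-3 3F ()
  on-3 4F ()
  mono-1 : NbhdMono G col 1F
  mono-1 u v p q = trans (on-1 u p) (sym (on-1 v q))
  mono-3 : NbhdMono G col 3F
  mono-3 u v p q = trans (on-3 u p) (sym (on-3 v q))
  max : ∀ k (c : Fin 5 → Fin k) → Surjective _≡_ _≡_ c → IsMVDColoring G c → k ≤ 2
  -- 0, 1 and 2 are common neighbours of 3 and 4, while 3 and 4 are common neighbours of 0 and 1.
  max k c sur mvd = colours≤ sur (0F ∷ 3F ∷ []) λ
    { 0F → here refl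
    ; 1F → here (common-neighbours-mono G mvd {3F} {4F} ((λ ()) , refl) refl refl refl refl)
    ; 2F → here (common-neighbours-mono G mvd {3F} {4F} ((λ ()) , refl) refl refl refl refl)
    ; 3F → there (here refl)
    ; 4F → there (here (common-neighbours-mono G mvd {0F} {1F} ((λ ()) , refl) refl refl refl refl))
    }

-- Extremal graph: the complement of a path on 5 vertices, whose middle vertex gets the second colour.
maxEdges-2 : ∀ m → let n = 6 + m in MaxEdges n 2 (choose2 n ∸ 4)
maxEdges-2 m = extremal es
  (s≤s z≤n ∷ s≤s (s≤s z≤n) ∷ s≤s (s≤s (s≤s z≤n)) ∷ s≤s (s≤s (s≤s (s≤s z≤n))) ∷ [])
  (universal-connected G 5F joined)
  ((col , surjective (λ { 0F → 0F , refl ; 1F → 2F , refl })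
        , co-MVD es (inj₁ mono-1 ∷ inj₂ mono-1 ∷ inj₁ mono-3 ∷ inj₂ mono-3 ∷ []))
  , max)
  (∸+≤ (≤-trans (s≤s (s≤s (s≤s (s≤s z≤n)))) (n≤choose2 {n} (s≤s (s≤s (s≤s z≤n))))))
  (λ H mvd → edgeCount≤ H (at-least-4 H (m≤m+n 5 (suc m)) mvd (m≤m+n 6 m) (missing-covers H) (missing-nonedges H)))
  where
  n : ℕ
  n = 6 + m
  es : List (Pair n)
  es = (1F , 0F) ∷ (2F , 1F) ∷ (3F , 2F) ∷ (4F , 3F) ∷ []
  G : Graph n
  G = coGraph es
  joined : ∀ v → v ≢ 5F → adj G v 5F ≡ true
  joined 0F _ = refl
  joined 1F _ = refl
  joined 2F _ = refl
  joined 3F _ = refl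
  joined 4F _ = refl
  joined 5F v≢ = contradiction refl v≢
  joined (suc (suc (suc (suc (suc (suc v)))))) _ = refl
  -- The neighbourhoods of 1 and 3 avoid 2, hence have one colour, and every missing edge contains 1
  -- or 3.
  col : Fin n → Fin 2
  col 2F = 1F
  col _  = 0F
  on-1 : ∀ v → adj G 1F v ≡ true → col v ≡ 0F
  on-1 0F _ = refl
  on-1 1F _ = refl
  on-1 2F ()
  on-1 (suc (suc (suc v))) _ = refl
  on-3 : ∀ v → adj G 3F v ≡ true → col v ≡ 0F
  on-3 0F _ = refl
  on-3 1F _ = refl
  on-3 2F ()
  on-3 (suc (suc (suc v))) _ = refl
  mono-1 : NbhdMono G col 1F
  mono-1 u v p q = trans (on-1 u p) (sym (on-1 v q))
  mono-3 : NbhdMono G col 3F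
  mono-3 u v p q = trans (on-3 u p) (sym (on-3 v q))
  max : ∀ k (c : Fin n → Fin k) → Surjective _≡_ _≡_ c → IsMVDColoring G c → k ≤ 2
  -- Vertex 5 is a common neighbour both of 3 and 4 and of 0 and 1, so it ties the two sets of
  -- common neighbours to one colour; only 2 escapes.
  max k c sur mvd = colours≤ sur (5F ∷ 2F ∷ []) λ
    { 0F → here (common-neighbours-mono G mvd {3F} {4F} ((λ ()) , refl) refl refl refl refl)
    ; 1F → here (common-neighbours-mono G mvd {3F} {4F} ((λ ()) , refl) refl refl refl refl)
    ; 2F → there (here refl)
    ; 3F → here (common-neighbours-mono G mvd {0F} {1F} ((λ ()) , refl) refl refl refl refl)
    ; 4F → here (common-neighbours-mono G mvd {0F} {1F} ((λ ()) , refl) refl refl refl refl)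
    ; 5F → here refl
    ; (suc (suc (suc (suc (suc (suc v)))))) →
        here (common-neighbours-mono G mvd {0F} {1F} ((λ ()) , refl) refl refl refl refl)
    }

-- Extremal graph: vertex 0 misses exactly 1, …, k − 2, and v has colour min (v , k − 1), where k = 3 + t.
maxEdges-≥3 : ∀ t n′ → 3 + t ≤ n′ → let n = suc n′ ; k = 3 + t in MaxEdges n k (choose2 n ∸ k + 2)
maxEdges-≥3 t n′ k≤n′ = extremal es ordered (universal-connected G hub joined)
  ((col , surjective onto , co-MVD es (tabulate⁺ {f = spoke} λ _ → inj₂ mono)) , max) low up
  where
  n k : ℕ
  n = suc n′
  k = 3 + t
  1+t≤n′ : suc t ≤ n′
  1+t≤n′ = ≤-trans (≤-trans (n≤1+n _) (n≤1+n _)) k≤n′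
  leaf : Fin (suc t) → Fin n
  leaf j = suc (inject≤ j 1+t≤n′)
  spoke : Fin (suc t) → Pair n
  spoke j = leaf j , 0F
  es : List (Pair n)
  es = tabulate spoke
  G : Graph n
  G = coGraph es
  length-es : length es ≡ suc t
  length-es = length-tabulate spoke
  ordered : Ordered es
  ordered = tabulate⁺ {f = spoke} λ _ → s≤s z≤n
  toℕ-leaf : ∀ j → toℕ (leaf j) ≡ suc (toℕ j)
  toℕ-leaf j = cong suc (toℕ-inject≤ j 1+t≤n′)

  2+t≤n′ : suc t < n′
  2+t≤n′ = ≤-trans (n≤1+n _) k≤n′
  -- Vertex k - 1, the first one past the leaves.
  hub : Fin n
  hub = suc (fromℕ< 2+t≤n′)
  joined : ∀ v → v ≢ hub → adj G v hub ≡ true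
  joined v v≢ = co-adj es λ
    { (inj₁ eq) → v≢ eq
    ; (inj₂ (inj₁ m)) → case ∈-tabulate⁻ {f = spoke} m of λ { (_ , ()) }
    -- Leaves are numbered at most k - 2, below the hub.
    ; (inj₂ (inj₂ m)) → let j , eq = ∈-tabulate⁻ {f = spoke} m in
        <-irrefl (trans (sym (trans (cong (toℕ ∘ proj₁) eq) (toℕ-leaf j))) (cong suc (toℕ-fromℕ< 2+t≤n′)))
          (s≤s (toℕ<n j)) }

  col : Fin n → Fin k
  col v = fromℕ< {toℕ v ⊓ (2 + t)} (s≤s (m⊓n≤n (toℕ v) (2 + t)))
  toℕ-col : ∀ v → toℕ (col v) ≡ toℕ v ⊓ (2 + t)
  toℕ-col v = toℕ-fromℕ< (s≤s (m⊓n≤n (toℕ v) (2 + t)))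
  k≤n : k ≤ n
  k≤n = ≤-trans k≤n′ (n≤1+n _)
  onto : ∀ j → ∃ λ v → col v ≡ j
  onto j = inject≤ j k≤n , toℕ-injective (begin
    toℕ (col (inject≤ j k≤n))        ≡⟨ toℕ-col (inject≤ j k≤n) ⟩
    toℕ (inject≤ j k≤n) ⊓ (2 + t)    ≡⟨ cong (_⊓ (2 + t)) (toℕ-inject≤ j k≤n) ⟩
    toℕ j ⊓ (2 + t)                  ≡⟨ m≤n⇒m⊓n≡m (s≤s⁻¹ (toℕ<n j)) ⟩
    toℕ j                            ∎)
    where open ≡-Reasoning
  -- The neighbours of 0 start at k - 1, exactly where the colouring becomes constant.
  far : ∀ v → adj G 0F v ≡ true → 2 + t ≤ toℕ v
  far v 0v = ≮⇒≥ λ v<2+t → contradiction (trans (sym 0v) (near v v<2+t)) λ ()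
    where
    near : ∀ v → toℕ v < 2 + t → adj G 0F v ≡ false
    near zero    _           = irrefl G 0F
    near (suc v) (s≤s v<1+t) = trans (adj-sym G 0F (suc v)) (co-nonadj es
      (subst (λ u → (suc u , 0F) ∈ˡ es)
        (toℕ-injective (trans (toℕ-inject≤ (fromℕ< v<1+t) 1+t≤n′) (toℕ-fromℕ< v<1+t)))
        (∈-tabulate⁺ {f = spoke} (fromℕ< v<1+t))))
  mono : NbhdMono G col 0F
  mono u v 0u 0v = toℕ-injective (trans (top u 0u) (sym (top v 0v)))
    where
    top : ∀ v → adj G 0F v ≡ true → toℕ (col v) ≡ 2 + t
    top v 0v = trans (toℕ-col v) (m≥n⇒m⊓n≡n (far v 0v))
  max : ∀ m (c : Fin n → Fin m) → Surjective _≡_ _≡_ c → IsMVDColoring G c → m ≤ k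
  max m c sur mvd = begin
    -- The general bound is attained: exactly the k - 2 spokes are available as missing edges.
    m                          ≤⟨ colours≤2+missing G sur mvd {leaf 0F} {0F} ((λ ()) , co-nonadj es {leaf 0F} {0F} (∈-tabulate⁺ {f = spoke} 0F)) ⟩
    2 + length (missing G)     ≤⟨ +-monoʳ-≤ 2 (missing-co≤ es ordered) ⟩
    2 + length es              ≡⟨ cong (2 +_) length-es ⟩
    k                          ∎
    where open ≤-Reasoning

  k≤choose2 : k ≤ choose2 n
  k≤choose2 = ≤-trans k≤n (n≤choose2 (≤-trans (s≤s (s≤s (s≤s z≤n))) k≤n))
  low : choose2 n ∸ k + 2 + length es ≤ choose2 n
  low = begin
    choose2 n ∸ k + 2 + length es   ≡⟨ cong (choose2 n ∸ k + 2 +_) length-es ⟩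
    choose2 n ∸ k + 2 + suc t       ≡⟨ +-assoc (choose2 n ∸ k) 2 (suc t) ⟩
    choose2 n ∸ k + k               ≤⟨ ∸+≤ k≤choose2 ⟩
    choose2 n                       ∎
    where open ≤-Reasoning
  up : ∀ (H : Graph n) → MvdIs H k → edgeCount H ≤ choose2 n ∸ k + 2
  up H mvd = begin
    edgeCount H               ≤⟨ edgeCount≤ H (s≤s⁻¹ (s≤s⁻¹ (mvd<n⇒≤2+missing H (s≤s k≤n′) mvd))) ⟩
    -- `suc t` is k - 2. Subtracting 2 more and adding it back cannot lower a truncated difference,
    -- which gives the stated form.
    choose2 n ∸ suc t         ≤⟨ m≤n+m∸n (choose2 n ∸ suc t) 2 ⟩
    2 + (choose2 n ∸ suc t ∸ 2)   ≡⟨ +-comm 2 _ ⟩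
    choose2 n ∸ suc t ∸ 2 + 2     ≡⟨ cong (_+ 2) (trans (∸-+-assoc (choose2 n) (suc t) 2) (cong (choose2 n ∸_) (+-comm (suc t) 2))) ⟩
    choose2 n ∸ k + 2             ∎
    where open ≤-Reasoning

-- The complement of the empty list is the complete graph, and a surjective colouring has at most as
-- many colours as vertices.
maxEdges-n : ∀ n′ → let n = suc n′ in MaxEdges n n (choose2 n)
maxEdges-n n′ = extremal [] [] (universal-connected G 0F joined) ((id , complete-colouring G (co-covers [])) , max)
  (≤-reflexive (+-identityʳ _)) (λ H _ → edgeCount≤ H z≤n)
  where
  G : Graph (suc n′)
  G = coGraph []
  joined : ∀ v → v ≢ 0F → adj G v 0F ≡ true
  joined v v≢ = co-adj [] λ { (inj₁ eq) → v≢ eq ; (inj₂ (inj₁ ())) ; (inj₂ (inj₂ ())) }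
  max : ∀ m (c : Fin (suc n′) → Fin m) → Surjective _≡_ _≡_ c → IsMVDColoring G c → m ≤ suc n′
  max m c sur _ = ≤-trans (colours≤ sur (allFin (suc n′)) λ v → Any.map (cong c) (∈-allFin v))
    (≤-reflexive (length-tabulate {n = suc n′} id))

theorem1p5 : ∀ (n k : ℕ) → 4 < n → 1 ≤ k → k ≤ n →
    (k ≡ 1 → MaxEdges n k (choose2 n ∸ 2)) ×
    (k ≡ 2 → n ≡ 5 → MaxEdges n k 7) ×
    (k ≡ 2 → 6 ≤ n → MaxEdges n k (choose2 n ∸ 4)) ×
    (3 ≤ k → k ≤ n ∸ 1 → MaxEdges n k (choose2 n ∸ k + 2)) ×
    (k ≡ n → MaxEdges n k (choose2 n))
-- Matching on the inequalities exposes `n` as `5 + m` or `6 + l` and `k` as `3 + t`, the forms on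
-- which the constructions are built.
theorem1p5 n k (s≤s (s≤s (s≤s (s≤s (s≤s (z≤n {m})))))) 1≤k k≤n =
    (λ { refl → maxEdges-1 m })
  , (λ { refl refl → maxEdges-2-5 })
  , (λ { refl (s≤s (s≤s (s≤s (s≤s (s≤s (s≤s (z≤n {l}))))))) → maxEdges-2 l })
  , (λ { (s≤s (s≤s (s≤s (z≤n {t})))) k≤ → maxEdges-≥3 t (4 + m) k≤ })
  , (λ { refl → maxEdges-n (4 + m) })
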